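{- Let $n\equiv 3\pmod 4$ with $n>3$. Let $1\le r<m$, let $M_r\in\mathfrak{C}_r$, and suppose $\det\tilde M_r>0$. Then $$\max\{\det E: E\in\mathfrak{E}_m\}>(n-3)\max\{\det E: E\in\mathfrak{E}_{m-1}\}.$$
   Context: Fix an integer $n\equiv 3\pmod 4$, $n>3$. For $m\ge1$, $\mathfrak{C}_m$ is the set of symmetric positive definite $m\times m$ integer matrices $C=(c_{ij})$ with $c_{ii}=n$ and $c_{ij}\equiv n\pmod 4$ for all $i,j$ (a finite set, since positive definiteness forces $|c_{ij}|<n$ for $i\neq j$). Given a fixed $M_r\in\mathfrak{C}_r$, for $m\ge r$, $\mathfrak{E}_m$ is the set of $E_m\in\mathfrak{C}_m$ whose leading $r\times r$ submatrix is $M_r$. For a square matrix $C$ of order $m$, $\tilde C$ denotes the matrix obtained from $C$ by replacing its $(m,m)$ entry by $3$. -}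

module Defs where

open import Data.Fin.Base using (zero; suc; toℕ; fromℕ; inject≤; punchIn)
open import Data.Integer.Base
  using (ℤ; +_; _*_; _-_; _^_; _≤_; _<_; 0ℤ; 1ℤ; -1ℤ)
open import Data.Integer.Divisibility.Signed using (_∣_)
open import Data.Integer.Properties using (+-*-semiring)
open import Data.Nat.Base as ℕ using (ℕ; zero; suc)
open import Data.Product.Base using (Σ-syntax; ∃-syntax; _×_)
open import Data.Vec.Functional using (Vector; updateAt)
open import Function.Base using (const)
open import Relation.Binary.PropositionalEquality.Core using (_≡_; _≢_)
open import Relation.Unary using (Pred; _∈_)
open import Level using (0ℓ)

open import Algebra.Properties.Semiring.Sum +-*-semiring using (sum-syntax)

infix 4 _≡_[mod_]

_≡_[mod_] : ℤ → ℤ → ℤ → Set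
a ≡ b [mod k ] = k ∣ (a - b)

Matrix : ℕ → Set
Matrix m = Vector (Vector ℤ m) m

-- Laplace expansion along the first row.
det : ∀ {m} → Matrix m → ℤ
det {zero}  C = 1ℤ
det {suc m} C =
  ∑[ j < suc m ] (-1ℤ ^ toℕ j * C zero j * det (λ i k → C (suc i) (punchIn j k)))

Symmetric : ∀ {m} → Matrix m → Set
Symmetric C = ∀ i j → C i j ≡ C j i

-- Testing integer vectors suffices for an integer matrix: clearing
-- denominators gives positivity on nonzero rational vectors, hence
-- semidefiniteness over the reals by density; a nonzero real isotropic vector
-- would then lie in the kernel, which would contain a nonzero integer vector.
PositiveDefinite : ∀ {m} → Matrix m → Set
PositiveDefinite {m} C =
  ∀ (x : Vector ℤ m) → ∃[ i ] x i ≢ 0ℤ →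
  0ℤ < ∑[ i < m ] (∑[ j < m ] (x i * C i j * x j))

record ℭ (n : ℤ) (m : ℕ) (C : Matrix m) : Set where
  field
    symmetric        : Symmetric C
    positiveDefinite : PositiveDefinite C
    diagonal         : ∀ i → C i i ≡ n
    congruent        : ∀ i j → C i j ≡ n [mod + 4 ]

LeadingSubmatrix : ∀ {r m} → Matrix r → Matrix m → Set
LeadingSubmatrix {r} {m} M C =
  Σ[ r≤m ∈ r ℕ.≤ m ] (∀ i j → C (inject≤ i r≤m) (inject≤ j r≤m) ≡ M i j)

𝔈 : (n : ℤ) {r : ℕ} (M : Matrix r) (m : ℕ) → Pred (Matrix m) 0ℓ
𝔈 n M m E = E ∈ ℭ n m × LeadingSubmatrix M E

-- A 0 × 0 matrix has no last entry and is left unchanged.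
tilde : ∀ {m} → Matrix m → Matrix m
tilde {zero}  C = C
tilde {suc m} C =
  updateAt C (fromℕ m) (λ row → updateAt row (fromℕ m) (const (+ 3)))

dets : ∀ {m} → Pred (Matrix m) 0ℓ → Pred ℤ 0ℓ
dets P d = ∃[ E ] E ∈ P × det E ≡ d

infix 4 _IsMaxOf_

_IsMaxOf_ : ℤ → Pred ℤ 0ℓ → Set
d IsMaxOf S = d ∈ S × (∀ e → e ∈ S → e ≤ d)

{-# OPTIONS --safe #-}

-- Let E be a determinant-maximal member of 𝔈_p with det Ẽ > 0, and let F arise
-- from Ẽ by repeating its last row and column and restoring n at the two last
-- diagonal places. Then det F = (n − 3)(det E + det Ẽ) > (n − 3) det E, and F is
-- positive definite because det F > 0 and its leading submatrix E is positive
-- definite. Hence a maximal G in 𝔈_{p+1} has det G > (n − 3) det E. Since the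
-- leading submatrix of G lies in 𝔈_p and has determinant at most det E,
-- det G̃ = det G − (n − 3) det (leading G) > 0, and the argument repeats, starting
-- from E = M_r.
module Submission where

open import Defs
open import Data.Fin.Base using (Fin; zero; suc; toℕ; fromℕ; inject₁; inject≤; punchIn)
open import Data.Fin.Properties as Fin using (any?; all?)
open import Data.Fin.Relation.Unary.Top using (view; ‵fromℕ; ‵inject₁)
open import Data.Integer.Base
  using (ℤ; +_; -[1+_]; +[1+_]; _+_; _*_; _-_; -_; _^_; ∣_∣; _<_; _≤_; _>_; +<+; +≤+;
         nonNegative; >-nonZero; 0ℤ; 1ℤ; -1ℤ)
open import Data.Integer.Divisibility.Signed using (_∣?_; divides)
open import Data.Integer.Properties
open import Data.Integer.Tactic.RingSolver using (solve-∀)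
open import Data.List.Base as List using (List; _++_; cartesianProductWith; filter; upTo)
open import Data.List.Extrema ≤-totalOrder using (argmax; argmax-all; f[xs]≤f[argmax])
open import Data.List.Membership.Propositional using (find) renaming (_∈_ to _∈ₗ_)
open import Data.List.Membership.Propositional.Properties
  using (∈-++⁺ˡ; ∈-++⁺ʳ; ∈-map⁺; ∈-upTo⁺; ∈-filter⁺)
import Data.List.Relation.Unary.All as All
open import Data.List.Relation.Unary.All.Properties using (all-filter)
open import Data.List.Relation.Unary.Any using (Any; here)
open import Data.List.Relation.Unary.Any.Properties using (cartesianProductWith⁺)
open import Data.Nat.Base as ℕ using (ℕ; zero; suc; _∸_)
import Data.Nat.Properties as ℕ
open import Data.Product.Base using (∃; ∃-syntax; _×_; _,_; proj₁; proj₂)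
open import Data.Unit.Base using (⊤; tt)
open import Data.Vec.Functional using (Vector; _∷_; init; last; insertAt; updateAt)
open import Data.Vec.Functional.Properties
  using (updateAt-updates; updateAt-minimal; insertAt-lookup; insertAt-punchIn)
open import Function.Base using (_∘_; const)
open import Relation.Binary.PropositionalEquality
open import Relation.Nullary.Decidable using (Dec; yes; no; map′; _×-dec_; ¬?; decidable-stable)
open import Relation.Nullary.Negation using (contradiction)
open import Relation.Unary using (_∈_)

open import Algebra.Properties.Semiring.Sum +-*-semiring
  using (sum; sum-syntax; sum-cong-≗; ∑-distrib-+; *-distribˡ-sum)

open ≡-Reasoning

-- Two mismatches between the definitions and the argument shape the development. `det` expands
-- along the first row, while `tilde` and the doubling change the last one, so expansion along the
-- last row and its linearity have to be derived. `PositiveDefinite` quantifies over all integer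
-- vectors, so it can neither be tested directly nor compared with a determinant. Both are needed: a
-- test selects the members of a finite list among which a maximum is taken, and a determinant
-- admits the doubled matrix. Positivity of the pivots of division-free elimination serves both
-- ends: completing the square ties the pivots to the quadratic form, and Chiò's identity ties them
-- to determinants. The constant 3 lies below n in the same class modulo 4. It may therefore stand
-- off the diagonal, where the repeated row meets the original column, and its distance n - 3 from
-- the diagonal value is the factor in the bound.

private
  variable
    m : ℕ

-- Signs and the removal of two columns in either order

*-*-distribˡ-sum : ∀ x y (z : Vector ℤ m) → x * (y * sum z) ≡ ∑[ k < m ] (x * (y * z k))
*-*-distribˡ-sum x y z =
  trans (cong (x *_) (*-distribˡ-sum y z)) (*-distribˡ-sum x (λ k → y * z k))

sgn : Fin m → ℤ
sgn j = -1ℤ ^ toℕ j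

sgn² : ∀ m → -1ℤ ^ m * -1ℤ ^ m ≡ 1ℤ
sgn² zero    = refl
sgn² (suc m) = trans (lem (-1ℤ ^ m)) (sgn² m)
  where
  lem : ∀ x → (-1ℤ * x) * (-1ℤ * x) ≡ x * x
  lem = solve-∀

dropColumn : ∀ {k} → Vector (Vector ℤ (suc m)) k → Fin (suc m) → Vector (Vector ℤ m) k
dropColumn T j i k = T i (punchIn j k)

-- Matrices are functions, and entrywise equality does not yield `≡` between them; hence each notion
-- used later gets its own congruence lemma.
det-cong : {C D : Matrix m} → (∀ i j → C i j ≡ D i j) → det C ≡ det D
det-cong {zero}  C≗D = refl
det-cong {suc m} C≗D = sum-cong-≗ λ j →
  cong₂ (λ x y → sgn j * x * y) (C≗D zero j)
    (det-cong λ i k → C≗D (suc i) (punchIn j k))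

-- Deleting column j and then column k of the rest removes the same two columns
-- as deleting column j′ and then column k′; the order of removal is exchanged.
data Swap : Fin (suc m) → Fin m → Fin (suc m) → Fin m → Set where
  base : {k : Fin (suc m)} → Swap zero k (suc k) zero
  step : {j j′ : Fin (suc m)} {k k′ : Fin m} →
         Swap j k j′ k′ → Swap (suc j) (suc k) (suc j′) (suc k′)

swap-punchInˡ : ∀ {j j′ : Fin (suc m)} {k k′} → Swap j k j′ k′ → punchIn j k ≡ j′
swap-punchInˡ base     = refl
swap-punchInˡ (step s) = cong suc (swap-punchInˡ s)

swap-punchInʳ : ∀ {j j′ : Fin (suc m)} {k k′} → Swap j k j′ k′ → punchIn j′ k′ ≡ j
swap-punchInʳ base     = refl
swap-punchInʳ (step s) = cong suc (swap-punchInʳ s)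

swap-punchIn : ∀ {j j′ : Fin (suc (suc m))} {k k′} → Swap j k j′ k′ → ∀ l →
               punchIn j (punchIn k l) ≡ punchIn j′ (punchIn k′ l)
swap-punchIn base     l       = refl
swap-punchIn (step s) zero    = refl
swap-punchIn {suc m} (step s) (suc l) = cong suc (swap-punchIn s l)

-- In a swap `j′` is `k + 1` and `k′` is `j` as numbers, because the column deleted second has lost
-- one predecessor. The index sums thus differ by one.
swap-sgn : ∀ {j j′ : Fin (suc m)} {k k′} → Swap j k j′ k′ →
           sgn j * sgn k ≡ -1ℤ * (sgn j′ * sgn k′)
swap-sgn (base {k = k}) = lem (sgn k)
  where
  lem : ∀ x → 1ℤ * x ≡ -1ℤ * ((-1ℤ * x) * 1ℤ)
  lem = solve-∀
swap-sgn (step {j = j} {j′} {k} {k′} s) = begin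
  (-1ℤ * sgn j) * (-1ℤ * sgn k)           ≡⟨ lem (sgn j) (sgn k) ⟩
  sgn j * sgn k                           ≡⟨ swap-sgn s ⟩
  -1ℤ * (sgn j′ * sgn k′)                 ≡⟨ cong (-1ℤ *_) (lem (sgn j′) (sgn k′)) ⟨
  -1ℤ * ((-1ℤ * sgn j′) * (-1ℤ * sgn k′)) ∎
  where
  lem : ∀ x y → (-1ℤ * x) * (-1ℤ * y) ≡ x * y
  lem = solve-∀

-- Swapping pairs off all index pairs. `Swap` records each couple only with the smaller column
-- first, so the hypothesis asks for both directions. The row and the column of index `zero` are
-- exchanged by `base`; what remains is the same sum one size smaller, reached through `step`.
∑-swap : (f g : Fin (suc m) → Fin m → ℤ) →
         (∀ {j k j′ k′} → Swap j k j′ k′ → f j k ≡ g j′ k′ × f j′ k′ ≡ g j k) →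
         ∑[ j < suc m ] ∑[ k < m ] f j k ≡ ∑[ j < suc m ] ∑[ k < m ] g j k
∑-swap {zero}  f g f≡g = refl
∑-swap {suc m} f g f≡g = begin
  f₀ + ∑[ j < suc m ] (f (suc j) zero + ∑[ k < m ] f (suc j) (suc k))
    ≡⟨ cong (λ x → f₀ + x) (∑-distrib-+ (λ j → f (suc j) zero) (λ j → ∑[ k < m ] f (suc j) (suc k))) ⟩
  f₀ + (∑[ j < suc m ] f (suc j) zero + ∑[ j < suc m ] ∑[ k < m ] f (suc j) (suc k))
    ≡⟨ cong₂ (λ x y → x + y)
         (sum-cong-≗ λ k → proj₁ (f≡g (base {k = k})))
         (cong₂ _+_ (sum-cong-≗ λ k → proj₂ (f≡g (base {k = k})))
                    (∑-swap _ _ (f≡g ∘ step))) ⟩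
  g₁ + (g₀ + g₂)
    ≡⟨ lem g₁ g₀ g₂ ⟩
  g₀ + (g₁ + g₂)
    ≡⟨ cong (λ x → g₀ + x) (∑-distrib-+ (λ j → g (suc j) zero) (λ j → ∑[ k < m ] g (suc j) (suc k))) ⟨
  g₀ + ∑[ j < suc m ] (g (suc j) zero + ∑[ k < m ] g (suc j) (suc k)) ∎
  where
  f₀ = ∑[ k < suc m ] f zero k
  g₀ = ∑[ k < suc m ] g zero k
  g₁ = ∑[ j < suc m ] g (suc j) zero
  g₂ = ∑[ j < suc m ] ∑[ k < m ] g (suc j) (suc k)
  lem : ∀ x y z → x + (y + z) ≡ y + (x + z)
  lem = solve-∀

i≡-i⇒i≡0 : ∀ {i} → i ≡ -1ℤ * i → i ≡ 0ℤ
i≡-i⇒i≡0 {+ zero} _ = refl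

-- This is the vanishing of a determinant with two equal rows `v`, expanded along both: `H` is the
-- complementary minor and `c` the sign left by the second expansion. Exchanging the two columns
-- reverses the sign of a term, so the sum is its own negative.
∑∑-alternating : (v : Vector ℤ (suc m)) (H : Fin (suc m) → Fin m → ℤ) →
  (∀ {j k j′ k′} → Swap j k j′ k′ → H j k ≡ H j′ k′) → ∀ c →
  ∑[ j < suc m ] (sgn j * v j * (c * ∑[ k < m ] (sgn k * v (punchIn j k) * H j k))) ≡ 0ℤ
∑∑-alternating {m} v H swap-H c = trans ∑≡∑∑ (i≡-i⇒i≡0 (begin
  ∑[ j < suc m ] ∑[ k < m ] f j k          ≡⟨ ∑-swap f (λ j k → -1ℤ * f j k) antisym ⟩
  ∑[ j < suc m ] ∑[ k < m ] (-1ℤ * f j k)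
    ≡⟨ sum-cong-≗ (λ j → *-distribˡ-sum -1ℤ (f j)) ⟨
  ∑[ j < suc m ] (-1ℤ * ∑[ k < m ] f j k)  ≡⟨ *-distribˡ-sum -1ℤ (λ j → sum (f j)) ⟨
  -1ℤ * ∑[ j < suc m ] ∑[ k < m ] f j k    ∎))
  where
  f : Fin (suc m) → Fin m → ℤ
  f j k = sgn j * v j * (c * (sgn k * v (punchIn j k) * H j k))

  ∑≡∑∑ : ∑[ j < suc m ] (sgn j * v j * (c * ∑[ k < m ] (sgn k * v (punchIn j k) * H j k)))
         ≡ ∑[ j < suc m ] ∑[ k < m ] f j k
  ∑≡∑∑ = sum-cong-≗ λ j →
    *-*-distribˡ-sum (sgn j * v j) c (λ k → sgn k * v (punchIn j k) * H j k)

  lem₁ : ∀ s x t y c h → s * x * (c * (t * y * h)) ≡ (s * t) * (x * y * (c * h))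
  lem₁ = solve-∀
  lem₂ : ∀ s x t y c h → (-1ℤ * (s * t)) * (y * x * (c * h)) ≡ -1ℤ * (s * x * (c * (t * y * h)))
  lem₂ = solve-∀

  half : ∀ {j k j′ k′} → Swap j k j′ k′ → f j k ≡ -1ℤ * f j′ k′
  half {j} {k} {j′} {k′} s
    rewrite swap-punchInˡ s | swap-punchInʳ s | swap-H s = begin
    sgn j * v j * (c * (sgn k * v j′ * H j′ k′))
      ≡⟨ lem₁ (sgn j) (v j) (sgn k) (v j′) c (H j′ k′) ⟩
    (sgn j * sgn k) * (v j * v j′ * (c * H j′ k′))
      ≡⟨ cong (_* (v j * v j′ * (c * H j′ k′))) (swap-sgn s) ⟩
    (-1ℤ * (sgn j′ * sgn k′)) * (v j * v j′ * (c * H j′ k′))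
      ≡⟨ lem₂ (sgn j′) (v j′) (sgn k′) (v j) c (H j′ k′) ⟩
    -1ℤ * (sgn j′ * v j′ * (c * (sgn k′ * v j * H j′ k′))) ∎

  antisym : ∀ {j k j′ k′} → Swap j k j′ k′ → f j k ≡ -1ℤ * f j′ k′ × f j′ k′ ≡ -1ℤ * f j k
  antisym {j} {k} {j′} {k′} s = half s ,
    trans (lem₃ (f j′ k′)) (cong (-1ℤ *_) (sym (half s)))
    where
    lem₃ : ∀ x → x ≡ -1ℤ * (-1ℤ * x)
    lem₃ = solve-∀

-- Expansion along the last row

-- The cofactor expansion with its global sign left out. The last row is a separate argument, so
-- that it can be split linearly or replaced while the minors stay fixed.
alongLast : Vector (Vector ℤ (suc m)) m → Vector ℤ (suc m) → ℤ
alongLast {m} T v = ∑[ j < suc m ] (sgn j * v j * det (dropColumn T j))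

-- Expanding the last row of each minor of the first row, and the first row of
-- each minor of the last row, gives the same double sum up to the order in
-- which the two columns are removed.
last-expansion : ∀ m (C : Matrix (suc m)) → det C ≡ -1ℤ ^ m * alongLast (init C) (last C)
last-expansion zero    C = sym (*-identityˡ _)
last-expansion (suc m) C = begin
  det C
    ≡⟨ sum-cong-≗ (λ j → trans
         (cong (sgn j * C zero j *_) (last-expansion m (dropColumn (C ∘ suc) j)))
         (*-*-distribˡ-sum (sgn j * C zero j) (-1ℤ ^ m) (λ k → sgn k * last C (punchIn j k) * H j k))) ⟩
  ∑[ j < suc (suc m) ] ∑[ k < suc m ] f j k
    ≡⟨ ∑-swap f g f≡g ⟩
  ∑[ j < suc (suc m) ] ∑[ k < suc m ] g j k
    ≡⟨ sum-cong-≗ (λ j → *-*-distribˡ-sum (-1ℤ ^ suc m) (sgn j * last C j)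
         (λ k → sgn k * C zero (punchIn j k) * H j k)) ⟨
  ∑[ j < suc (suc m) ] (-1ℤ ^ suc m * (sgn j * last C j * det (dropColumn (init C) j)))
    ≡⟨ *-distribˡ-sum (-1ℤ ^ suc m) (λ j → sgn j * last C j * det (dropColumn (init C) j)) ⟨
  -1ℤ ^ suc m * alongLast (init C) (last C) ∎
  where
  H : Fin (suc (suc m)) → Fin (suc m) → ℤ
  H j k = det (dropColumn (dropColumn (init (C ∘ suc)) j) k)

  f g : Fin (suc (suc m)) → Fin (suc m) → ℤ
  f j k = sgn j * C zero j * (-1ℤ ^ m * (sgn k * last C (punchIn j k) * H j k))
  g j k = -1ℤ ^ suc m * (sgn j * last C j * (sgn k * C zero (punchIn j k) * H j k))

  swap-H : ∀ {j k j′ k′} → Swap j k j′ k′ → H j k ≡ H j′ k′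
  swap-H s = det-cong λ i l → cong (init (C ∘ suc) i) (swap-punchIn s l)

  lem₁ : ∀ s x t y p h → s * x * (p * (t * y * h)) ≡ (s * t) * (p * (x * y * h))
  lem₁ = solve-∀
  lem₂ : ∀ s x t y p h → (-1ℤ * (s * t)) * (p * (x * y * h)) ≡ (-1ℤ * p) * (s * y * (t * x * h))
  lem₂ = solve-∀

  f≡g : ∀ {j k j′ k′} → Swap j k j′ k′ → f j k ≡ g j′ k′ × f j′ k′ ≡ g j k
  f≡g {j} {k} {j′} {k′} s
    rewrite swap-punchInˡ s | swap-punchInʳ s | swap-H s =
      trans (lem₁ (sgn j) (C zero j) (sgn k) (last C j′) (-1ℤ ^ m) (H j′ k′))
        (trans (cong (_* (-1ℤ ^ m * (C zero j * last C j′ * H j′ k′))) (swap-sgn s))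
          (lem₂ (sgn j′) (C zero j) (sgn k′) (last C j′) (-1ℤ ^ m) (H j′ k′))) ,
      trans (lem₁ (sgn j′) (C zero j′) (sgn k′) (last C j) (-1ℤ ^ m) (H j′ k′))
        (trans (cong (_* (-1ℤ ^ m * (C zero j′ * last C j * H j′ k′)))
               (sym (trans (cong (-1ℤ *_) (swap-sgn s)) (lem₃ (sgn j′ * sgn k′)))))
          (lem₂ (sgn j) (C zero j′) (sgn k) (last C j) (-1ℤ ^ m) (H j′ k′)))
    where
    lem₃ : ∀ x → -1ℤ * (-1ℤ * x) ≡ x
    lem₃ = solve-∀

swap-dropColumn : ∀ {n} (T : Vector (Vector ℤ (suc (suc m))) n) → ∀ {j k j′ k′} → Swap j k j′ k′ →
  ∀ i l → dropColumn (dropColumn T j) k i l ≡ dropColumn (dropColumn T j′) k′ i l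
swap-dropColumn T s i l = cong (T i) (swap-punchIn s l)

-- The minors are expanded along the row that is repeated: here their first row, with sign 1, and in
-- `alongLast-last` their last row, with sign `-1ℤ ^ m`.
alongLast-first : ∀ (T : Vector (Vector ℤ (suc (suc m))) (suc m)) → alongLast T (T zero) ≡ 0ℤ
alongLast-first T = trans
  (sum-cong-≗ λ j → cong (sgn j * T zero j *_) (sym (*-identityˡ (det (dropColumn T j)))))
  (∑∑-alternating (T zero) (λ j k → det (dropColumn (dropColumn (T ∘ suc) j) k))
    (λ s → det-cong (swap-dropColumn (T ∘ suc) s)) 1ℤ)

alongLast-last : ∀ (T : Vector (Vector ℤ (suc (suc m))) (suc m)) → alongLast T (last T) ≡ 0ℤ
alongLast-last {m} T = trans
  (sum-cong-≗ λ j → cong (sgn j * last T j *_) (last-expansion m (dropColumn T j)))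
  (∑∑-alternating (last T) (λ j k → det (dropColumn (dropColumn (init T) j) k))
    (λ s → det-cong (swap-dropColumn (init T) s)) (-1ℤ ^ m))

-- Linearity, row operations and Chiò condensation

sum-zero : {f : Vector ℤ m} → (∀ i → f i ≡ 0ℤ) → sum f ≡ 0ℤ
sum-zero {zero}  f≡0 = refl
sum-zero {suc m} f≡0 = cong₂ _+_ (f≡0 zero) (sum-zero (f≡0 ∘ suc))

sum-linear : ∀ s t (f g : Vector ℤ m) →
             ∑[ i < m ] (s * f i + t * g i) ≡ s * sum f + t * sum g
sum-linear s t f g = begin
  sum (λ i → s * f i + t * g i)             ≡⟨ ∑-distrib-+ (λ i → s * f i) (λ i → t * g i) ⟩
  sum (λ i → s * f i) + sum (λ i → t * g i) ≡⟨ cong₂ _+_ (*-distribˡ-sum s f) (*-distribˡ-sum t g) ⟨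
  s * sum f + t * sum g                     ∎

alongLast-linear : ∀ (T : Vector (Vector ℤ (suc m)) m) s t v w →
  alongLast T (λ j → s * v j + t * w j) ≡ s * alongLast T v + t * alongLast T w
alongLast-linear T s t v w = trans
  (sum-cong-≗ λ j → lem (sgn j) s (v j) t (w j) (det (dropColumn T j)))
  (sum-linear s t (λ j → sgn j * v j * det (dropColumn T j)) (λ j → sgn j * w j * det (dropColumn T j)))
  where
  lem : ∀ σ s x t y d → σ * (s * x + t * y) * d ≡ s * (σ * x * d) + t * (σ * y * d)
  lem = solve-∀

alongLast-cong : ∀ {S T : Vector (Vector ℤ (suc m)) m} {v w} →
  (∀ i j → S i j ≡ T i j) → (∀ j → v j ≡ w j) → alongLast S v ≡ alongLast T w
alongLast-cong S≗T v≗w = sum-cong-≗ λ j →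
  cong₂ (λ x y → sgn j * x * y) (v≗w j) (det-cong λ i k → S≗T i (punchIn j k))

-- Induction from the bottom row upwards. Linearity in the last row separates off a multiple of `u`,
-- which repeats the first row and contributes nothing; each of the `m` lower rows releases one
-- factor `s`.
det-shear : ∀ m s (t : Vector ℤ m) (u : Vector ℤ (suc m)) (R : Vector (Vector ℤ (suc m)) m) →
  det (u ∷ λ i k → s * R i k + t i * u k) ≡ s ^ m * det (u ∷ R)
det-shear zero    s t u R = trans
  (det-cong {C = u ∷ λ i k → s * R i k + t i * u k} {D = u ∷ R} λ { zero k → refl })
  (sym (*-identityˡ (det (u ∷ R))))
det-shear (suc m) s t u R = begin
  det A
    ≡⟨ last-expansion (suc m) A ⟩
  σ * alongLast (init A) (last A)
    ≡⟨ cong (σ *_) (alongLast-linear (init A) s (last t) (last R) u) ⟩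
  σ * (s * alongLast (init A) (last R) + last t * alongLast (init A) u)
    ≡⟨ cong₂ (λ x y → σ * (s * x + last t * y)) minors (alongLast-first (init A)) ⟩
  σ * (s * (s ^ m * alongLast (init B) (last R)) + last t * 0ℤ)
    ≡⟨ lem σ s (s ^ m) (alongLast (init B) (last R)) (last t) ⟩
  s * s ^ m * (σ * alongLast (init B) (last R))
    ≡⟨ cong (s * s ^ m *_) (last-expansion (suc m) B) ⟨
  s ^ suc m * det B ∎
  where
  σ = -1ℤ ^ suc m
  A = u ∷ λ i k → s * R i k + t i * u k
  B = u ∷ R

  lem : ∀ σ s p x t → σ * (s * (p * x) + t * 0ℤ) ≡ s * p * (σ * x)
  lem = solve-∀
  lem′ : ∀ x p d → x * (p * d) ≡ p * (x * d)
  lem′ = solve-∀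

  minor : ∀ j → det (dropColumn (init A) j) ≡ s ^ m * det (dropColumn (init B) j)
  minor j = begin
    det (dropColumn (init A) j)
      ≡⟨ det-cong {C = dropColumn (init A) j} {D = A′} (λ { zero k → refl ; (suc i) k → refl }) ⟩
    det A′
      ≡⟨ det-shear m s (init t) u′ R′ ⟩
    s ^ m * det (u′ ∷ R′)
      ≡⟨ cong (s ^ m *_) (det-cong {C = u′ ∷ R′} {D = dropColumn (init B) j}
           λ { zero k → refl ; (suc i) k → refl }) ⟩
    s ^ m * det (dropColumn (init B) j) ∎
    where
    u′ = u ∘ punchIn j
    R′ = dropColumn (init R) j
    A′ = u′ ∷ λ i k → s * R′ i k + init t i * u′ k

  minors : alongLast (init A) (last R) ≡ s ^ m * alongLast (init B) (last R)
  minors = trans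
    (sum-cong-≗ λ j → trans (cong (sgn j * last R j *_) (minor j))
      (lem′ (sgn j * last R j) (s ^ m) (det (dropColumn (init B) j))))
    (sym (*-distribˡ-sum (s ^ m) (λ j → sgn j * last R j * det (dropColumn (init B) j))))

det-zeroColumn : (C : Matrix (suc m)) → (∀ i → C i zero ≡ 0ℤ) → det C ≡ 0ℤ
det-zeroColumn {m} C C₀≡0 = cong₂ _+_
  (cong (λ x → 1ℤ * x * det (dropColumn (C ∘ suc) zero)) (C₀≡0 zero))
  (sum-zero (minors m C C₀≡0))
  where
  minors : ∀ m (C : Matrix (suc m)) → (∀ i → C i zero ≡ 0ℤ) → ∀ j →
           sgn (suc j) * C zero (suc j) * det (dropColumn (C ∘ suc) (suc j)) ≡ 0ℤ
  minors (suc m) C C₀≡0 j = trans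
    (cong (sgn (suc j) * C zero (suc j) *_)
      (det-zeroColumn (dropColumn (C ∘ suc) (suc j)) (C₀≡0 ∘ suc)))
    (*-zeroʳ (sgn (suc j) * C zero (suc j)))

-- The Schur complement of the top left entry multiplied by that entry, which keeps it integral.
schur : Matrix (suc m) → Matrix m
schur C i j = C zero zero * C (suc i) (suc j) + - C (suc i) zero * C zero (suc j)

-- Chiò's identity.
det-schur : (C : Matrix (suc m)) → C zero zero * det (schur C) ≡ C zero zero ^ m * det C
det-schur {m} C = begin
  a * det (schur C)                  ≡⟨ lem a (det (schur C)) ⟩
  1ℤ * a * det (schur C) + 0ℤ
    -- Below the pivot the first column of `A` is zero, and every minor except the first still
    -- contains that column.
    ≡⟨ cong (λ x → 1ℤ * a * det (schur C) + x) (sum-zero (minors C)) ⟨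
  det A                              ≡⟨ det-shear m a (λ i → - C (suc i) zero) (C zero) (C ∘ suc) ⟩
  a ^ m * det (C zero ∷ (C ∘ suc))
    ≡⟨ cong (a ^ m *_) (det-cong {C = C zero ∷ (C ∘ suc)} {D = C} λ { zero k → refl ; (suc i) k → refl }) ⟩
  a ^ m * det C                      ∎
  where
  a = C zero zero
  cleared : ∀ {m} → Matrix (suc m) → Vector (Vector ℤ (suc m)) m
  cleared C i k = C zero zero * C (suc i) k + - C (suc i) zero * C zero k
  A = C zero ∷ cleared C

  lem : ∀ a d → a * d ≡ 1ℤ * a * d + 0ℤ
  lem = solve-∀
  lem′ : ∀ a c → a * c + - c * a ≡ 0ℤ
  lem′ = solve-∀

  minors : ∀ {m} (C : Matrix (suc m)) (j : Fin m) →
           sgn (suc j) * C zero (suc j) * det (dropColumn (cleared C) (suc j)) ≡ 0ℤ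
  minors {suc m} C j = trans
    (cong (sgn (suc j) * C zero (suc j) *_)
      (det-zeroColumn (dropColumn (cleared C) (suc j)) λ i → lem′ (C zero zero) (C (suc i) zero)))
    (*-zeroʳ (sgn (suc j) * C zero (suc j)))

-- Pivots and positive definiteness

0<i*j : ∀ {i j} → 0ℤ < i → 0ℤ < j → 0ℤ < i * j
0<i*j {+[1+ _ ]} {+[1+ _ ]} _ _ = +<+ ℕ.z<s
0<i*j {+ zero} (+<+ ()) _
0<i*j {+[1+ _ ]} {+ zero} _ (+<+ ())

0<i^m : ∀ {i} m → 0ℤ < i → 0ℤ < i ^ m
0<i^m zero    0<i = +<+ ℕ.z<s
0<i^m (suc m) 0<i = 0<i*j 0<i (0<i^m m 0<i)

i<j⇒0<j-i : ∀ {i j} → i < j → 0ℤ < j - i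
i<j⇒0<j-i {i} {j} i<j = subst (_< j - i) (+-inverseʳ i) (+-monoˡ-< (- i) i<j)

0<i*j⇒0<j : ∀ {i j} → 0ℤ < i → 0ℤ < i * j → 0ℤ < j
0<i*j⇒0<j {i} {j} 0<i 0<ij =
  *-cancelˡ-<-nonNeg i {{nonNegative (<⇒≤ 0<i)}} (subst (_< i * j) (sym (*-zeroʳ i)) 0<ij)

0≤i*i : ∀ i → 0ℤ ≤ i * i
0≤i*i (+ zero)    = ≤-refl
0≤i*i (+[1+ _ ])  = +≤+ ℕ.z≤n
0≤i*i (-[1+ _ ])  = +≤+ ℕ.z≤n

0<i*i : ∀ {i} → i ≢ 0ℤ → 0ℤ < i * i
0<i*i {+ zero}     i≢0 = contradiction refl i≢0
0<i*i {+[1+ _ ]}   i≢0 = +<+ ℕ.z<s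
0<i*i { -[1+ _ ] } i≢0 = +<+ ℕ.z<s

leading : Matrix (suc m) → Matrix m
leading C i j = C (inject₁ i) (inject₁ j)

-- Fraction-free Gaussian elimination meets only positive pivots; unlike
-- positive definiteness this is visibly decidable.
Pivots : Matrix m → Set
Pivots {zero}  C = ⊤
Pivots {suc m} C = 0ℤ < C zero zero × Pivots (schur C)

-- `schur` and `leading` commute by computation, so the recursion needs no transport.
pivots-leading : (C : Matrix (suc m)) → Pivots C → Pivots (leading C)
pivots-leading {zero}  C _       = tt
pivots-leading {suc m} C (a , p) = a , pivots-leading (schur C) p

pivots⇒0<det : (C : Matrix m) → Pivots C → 0ℤ < det C
pivots⇒0<det {zero}  C _       = +<+ ℕ.z<s
pivots⇒0<det {suc m} C (a , p) = 0<i*j⇒0<j (0<i^m m a)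
  (subst (0ℤ <_) (det-schur C) (0<i*j a (pivots⇒0<det (schur C) p)))

-- The inductive step of Sylvester's criterion. Only the last pivot is new, and Chiò's identity
-- hands the positive determinant down through each elimination until the remaining matrix is that
-- pivot.
pivots-extend : (C : Matrix (suc m)) → Pivots (leading C) → 0ℤ < det C → Pivots C
pivots-extend {zero}  C _       0<det = subst (0ℤ <_) (lem (C zero zero)) 0<det , tt
  where
  lem : ∀ x → 1ℤ * x * 1ℤ + 0ℤ ≡ x
  lem = solve-∀
pivots-extend {suc m} C (a , p) 0<det = a , pivots-extend (schur C) p
  (0<i*j⇒0<j a (subst (0ℤ <_) (sym (det-schur C)) (0<i*j (0<i^m (suc m) a) 0<det)))

-- The quadratic form and completion of the square

quad : Matrix m → Vector ℤ m → ℤ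
quad {m} C x = ∑[ i < m ] ∑[ j < m ] (x i * C i j * x j)

∑∑-linear : ∀ s (b c : Vector ℤ m) (f : Fin m → Fin m → ℤ) →
  ∑[ i < m ] ∑[ j < m ] (s * f i j + b i * c j) ≡ s * ∑[ i < m ] ∑[ j < m ] f i j + sum c * sum b
∑∑-linear {m} s b c f = begin
  ∑[ i < m ] ∑[ j < m ] (s * f i j + b i * c j)
    ≡⟨ sum-cong-≗ (λ i → trans (sum-linear s (b i) (f i) c)
         (cong (λ x → s * sum (f i) + x) (*-comm (b i) (sum c)))) ⟩
  ∑[ i < m ] (s * sum (f i) + sum c * b i)
    ≡⟨ sum-linear s (sum c) (λ i → sum (f i)) b ⟩
  s * ∑[ i < m ] sum (f i) + sum c * sum b ∎

module _ (C : Matrix (suc m)) (symC : Symmetric C) (x : Vector ℤ (suc m)) where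
  private
    a = C zero zero
    x₀ = x zero
    y = x ∘ suc
    β = ∑[ j < m ] (C zero (suc j) * y j)
    D : Matrix m
    D i j = C (suc i) (suc j)

    ∑∑-schur : quad (schur C) y ≡ a * quad D y + β * (-1ℤ * β)
    ∑∑-schur = begin
      quad (schur C) y
        ≡⟨ sum-cong-≗ (λ i → sum-cong-≗ λ j → trans
             (cong (λ c → y i * (a * D i j + - c * C zero (suc j)) * y j) (symC (suc i) zero))
             (lem (y i) a (D i j) (C zero (suc i)) (C zero (suc j)) (y j))) ⟩
      ∑[ i < m ] ∑[ j < m ] (a * (y i * D i j * y j) + -1ℤ * (C zero (suc i) * y i) * (C zero (suc j) * y j))
        ≡⟨ ∑∑-linear a (λ i → -1ℤ * (C zero (suc i) * y i)) (λ j → C zero (suc j) * y j)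
             (λ i j → y i * D i j * y j) ⟩
      a * quad D y + β * ∑[ i < m ] (-1ℤ * (C zero (suc i) * y i))
        ≡⟨ cong (λ z → a * quad D y + β * z) (*-distribˡ-sum -1ℤ (λ i → C zero (suc i) * y i)) ⟨
      a * quad D y + β * (-1ℤ * β) ∎
      where
      lem : ∀ p a d b c q → p * (a * d + - b * c) * q ≡ a * (p * d * q) + -1ℤ * (b * p) * (c * q)
      lem = solve-∀

  quad-suc : quad C x ≡ x₀ * a * x₀ + (x₀ * β + x₀ * β) + quad D y
  quad-suc = begin
    x₀ * a * x₀ + ∑[ j < m ] (x₀ * C zero (suc j) * y j)
      + ∑[ i < m ] (y i * C (suc i) zero * x₀ + ∑[ j < m ] (y i * D i j * y j))
      ≡⟨ cong₂ (λ p q → x₀ * a * x₀ + p + q)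
           (trans (sum-cong-≗ λ j → *-assoc x₀ (C zero (suc j)) (y j))
             (sym (*-distribˡ-sum x₀ (λ j → C zero (suc j) * y j))))
           (trans (∑-distrib-+ (λ i → y i * C (suc i) zero * x₀) (λ i → ∑[ j < m ] (y i * D i j * y j)))
             (cong (λ p → p + quad D y) (trans
               (sum-cong-≗ λ i → trans (cong (λ c → y i * c * x₀) (symC (suc i) zero))
                 (lem (y i) (C zero (suc i)) x₀))
               (sym (*-distribˡ-sum x₀ (λ j → C zero (suc j) * y j)))))) ⟩
    x₀ * a * x₀ + x₀ * β + (x₀ * β + quad D y)
      ≡⟨ lem′ (x₀ * a * x₀) (x₀ * β) (quad D y) ⟩
    x₀ * a * x₀ + (x₀ * β + x₀ * β) + quad D y ∎
    where
    lem : ∀ p c q → p * c * q ≡ q * (c * p)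
    lem = solve-∀
    lem′ : ∀ p b q → p + b + (b + q) ≡ p + (b + b) + q
    lem′ = solve-∀

  -- Lagrange's reduction, multiplied by `a` to avoid division. Both directions between definiteness
  -- and positive pivots rest on it.
  complete-square : a * quad C x ≡ (a * x₀ + β) * (a * x₀ + β) + quad (schur C) y
  complete-square = begin
    a * quad C x                                             ≡⟨ cong (a *_) quad-suc ⟩
    a * (x₀ * a * x₀ + (x₀ * β + x₀ * β) + quad D y)         ≡⟨ lem a x₀ β (quad D y) ⟩
    (a * x₀ + β) * (a * x₀ + β) + (a * quad D y + β * (-1ℤ * β))
      ≡⟨ cong (λ z → (a * x₀ + β) * (a * x₀ + β) + z) ∑∑-schur ⟨
    (a * x₀ + β) * (a * x₀ + β) + quad (schur C) y           ∎
    where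
    lem : ∀ a x b q → a * (x * a * x + (x * b + x * b) + q)
          ≡ (a * x + b) * (a * x + b) + (a * q + b * (-1ℤ * b))
    lem = solve-∀

quad-zero : (C : Matrix m) {x : Vector ℤ m} → (∀ i → x i ≡ 0ℤ) → quad C x ≡ 0ℤ
quad-zero C {x} x≡0 = sum-zero λ i → sum-zero λ j →
  trans (cong (x i * C i j *_) (x≡0 j)) (*-zeroʳ (x i * C i j))

quad-scale : (C : Matrix m) (s : ℤ) (x : Vector ℤ m) → quad C (λ i → s * x i) ≡ s * s * quad C x
quad-scale C s x = trans
  (sum-cong-≗ λ i → trans (sum-cong-≗ λ j → lem s (x i) (C i j) (x j))
    (sym (*-distribˡ-sum (s * s) (λ j → x i * C i j * x j))))
  (sym (*-distribˡ-sum (s * s) (λ i → sum (λ j → x i * C i j * x j))))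
  where
  lem : ∀ s x c y → s * x * c * (s * y) ≡ s * s * (x * c * y)
  lem = solve-∀

schur-symmetric : {C : Matrix (suc m)} → Symmetric C → Symmetric (schur C)
schur-symmetric {C = C} symC i j
  rewrite symC (suc i) (suc j) | symC zero (suc j) | symC (suc i) zero =
    lem (C zero zero * C (suc j) (suc i)) (C zero (suc i)) (C (suc j) zero)
  where
  lem : ∀ x b c → x + - b * c ≡ x + - c * b
  lem = solve-∀

-- The first pivot is the value of the form at the first basis vector. A vector `y` for the Schur
-- complement lifts to one for `C` on which the completed square vanishes; taking `a * y` as its
-- tail makes the required first coordinate the integer `- β`.
positiveDefinite⇒pivots : (C : Matrix m) → Symmetric C → PositiveDefinite C → Pivots C
positiveDefinite⇒pivots {zero}  C symC pd = tt
positiveDefinite⇒pivots {suc m} C symC pd =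
  0<a , positiveDefinite⇒pivots (schur C) (schur-symmetric {C = C} symC) schur-pd
  where
  a = C zero zero

  e₀ : Vector ℤ (suc m)
  e₀ = 1ℤ ∷ const 0ℤ

  quad-e₀ : quad C e₀ ≡ a
  quad-e₀ = begin
    quad C e₀
      ≡⟨ quad-suc C symC e₀ ⟩
    1ℤ * a * 1ℤ + (1ℤ * ∑[ j < m ] (C zero (suc j) * 0ℤ) + 1ℤ * ∑[ j < m ] (C zero (suc j) * 0ℤ))
      + quad (λ i j → C (suc i) (suc j)) (const 0ℤ)
      ≡⟨ cong₂ (λ p q → 1ℤ * a * 1ℤ + (1ℤ * p + 1ℤ * p) + q)
           (sum-zero λ j → *-zeroʳ (C zero (suc j)))
           (quad-zero (λ i j → C (suc i) (suc j)) {const 0ℤ} λ _ → refl) ⟩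
    1ℤ * a * 1ℤ + (1ℤ * 0ℤ + 1ℤ * 0ℤ) + 0ℤ
      ≡⟨ lem a ⟩
    a ∎
    where
    lem : ∀ a → 1ℤ * a * 1ℤ + (1ℤ * 0ℤ + 1ℤ * 0ℤ) + 0ℤ ≡ a
    lem = solve-∀

  0<a : 0ℤ < a
  0<a = subst (0ℤ <_) quad-e₀ (pd e₀ (zero , λ ()))

  schur-pd : PositiveDefinite (schur C)
  schur-pd y (i , yᵢ≢0) = 0<i*j⇒0<j (0<i*j 0<a 0<a)
    (subst (0ℤ <_) eq (0<i*j 0<a (pd x (suc i , λ ayᵢ≡0 → yᵢ≢0 (ay≡0⇒y≡0 ayᵢ≡0)))))
    where
    β = ∑[ j < m ] (C zero (suc j) * y j)

    -- The first coordinate makes the completed square vanish.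
    x : Vector ℤ (suc m)
    x = - β ∷ λ i → a * y i

    ay≡0⇒y≡0 : ∀ {y} → a * y ≡ 0ℤ → y ≡ 0ℤ
    ay≡0⇒y≡0 {y} ay≡0 = *-cancelˡ-≡ a y 0ℤ {{>-nonZero 0<a}} (trans ay≡0 (sym (*-zeroʳ a)))

    β′ : ∑[ j < m ] (C zero (suc j) * (a * y j)) ≡ a * β
    β′ = trans (sum-cong-≗ λ j → lem (C zero (suc j)) a (y j))
      (sym (*-distribˡ-sum a (λ j → C zero (suc j) * y j)))
      where
      lem : ∀ c a y → c * (a * y) ≡ a * (c * y)
      lem = solve-∀

    eq : a * quad C x ≡ a * a * quad (schur C) y
    eq = begin
      a * quad C x
        ≡⟨ complete-square C symC x ⟩
      (a * - β + _) * (a * - β + _) + quad (schur C) (λ i → a * y i)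
        ≡⟨ cong₂ (λ b q → (a * - β + b) * (a * - β + b) + q) β′ (quad-scale (schur C) a y) ⟩
      (a * - β + a * β) * (a * - β + a * β) + a * a * quad (schur C) y
        ≡⟨ lem a β (a * a * quad (schur C) y) ⟩
      a * a * quad (schur C) y ∎
      where
      lem : ∀ a b q → (a * - b + a * b) * (a * - b + a * b) + q ≡ q
      lem = solve-∀

-- If the tail of `x` is nonzero, the Schur complement is positive on it by induction and the square
-- does no harm. Otherwise `x zero` is the nonzero coordinate and the square alone is positive.
pivots⇒positiveDefinite : (C : Matrix m) → Symmetric C → Pivots C → PositiveDefinite C
pivots⇒positiveDefinite {suc m} C symC (0<a , p) x (i , xᵢ≢0) =
  0<i*j⇒0<j 0<a (subst (0ℤ <_) (sym (complete-square C symC x))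
    (0<square (any? λ j → ¬? (x (suc j) ≟ 0ℤ))))
  where
  a = C zero zero
  y = x ∘ suc
  β = ∑[ j < m ] (C zero (suc j) * y j)

  0<square : Dec (∃ λ j → y j ≢ 0ℤ) → 0ℤ < (a * x zero + β) * (a * x zero + β) + quad (schur C) y
  0<square (yes y≢0) = +-mono-≤-< (0≤i*i (a * x zero + β))
    (pivots⇒positiveDefinite (schur C) (schur-symmetric {C = C} symC) p y y≢0)
  0<square (no y≡0) = subst (0ℤ <_) (sym eq) (0<i*j (0<i*j 0<a 0<a) (0<i*i x₀≢0))
    where
    y≗0 : ∀ j → y j ≡ 0ℤ
    y≗0 j = decidable-stable (y j ≟ 0ℤ) λ yⱼ≢0 → y≡0 (j , yⱼ≢0)

    nonzero-first : ∀ i → x i ≢ 0ℤ → x zero ≢ 0ℤ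
    nonzero-first zero    xᵢ≢0 = xᵢ≢0
    nonzero-first (suc j) xᵢ≢0 = contradiction (y≗0 j) xᵢ≢0

    x₀≢0 = nonzero-first i xᵢ≢0

    eq : (a * x zero + β) * (a * x zero + β) + quad (schur C) y ≡ a * a * (x zero * x zero)
    eq = trans
      (cong₂ (λ b q → (a * x zero + b) * (a * x zero + b) + q)
        (sum-zero λ j → trans (cong (C zero (suc j) *_) (y≗0 j)) (*-zeroʳ (C zero (suc j))))
        (quad-zero (schur C) y≗0))
      (lem a (x zero))
      where
      lem : ∀ a x → (a * x + 0ℤ) * (a * x + 0ℤ) + 0ℤ ≡ a * a * (x * x)
      lem = solve-∀

-- Doubling the last row and column

unit : Fin m → Vector ℤ m
unit zero    = 1ℤ ∷ const 0ℤ
unit (suc i) = 0ℤ ∷ unit i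

unit-diagonal : (i : Fin m) → unit i i ≡ 1ℤ
unit-diagonal zero    = refl
unit-diagonal (suc i) = unit-diagonal i

unit-off-diagonal : {i j : Fin m} → i ≢ j → unit i j ≡ 0ℤ
unit-off-diagonal {i = zero}  {zero}  i≢j = contradiction refl i≢j
unit-off-diagonal {i = zero}  {suc j} i≢j = refl
unit-off-diagonal {i = suc i} {zero}  i≢j = refl
unit-off-diagonal {i = suc i} {suc j} i≢j = unit-off-diagonal (i≢j ∘ cong suc)

sum-unit : ∀ i (f : Vector ℤ m) → ∑[ k < m ] (unit i k * f k) ≡ f i
sum-unit zero    f = trans
  (cong₂ _+_ (*-identityˡ (f zero)) (sum-zero {f = λ k → 0ℤ * f (suc k)} λ k → *-zeroˡ (f (suc k))))
  (+-identityʳ (f zero))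
sum-unit (suc i) f = trans (+-identityˡ _) (sum-unit i (f ∘ suc))

alongLast-unit : ∀ (T : Vector (Vector ℤ (suc m)) m) k →
                 alongLast T (unit k) ≡ sgn k * det (dropColumn T k)
alongLast-unit T k = trans
  (sum-cong-≗ λ j → lem (sgn j) (unit k j) (det (dropColumn T j)))
  (sum-unit k (λ j → sgn j * det (dropColumn T j)))
  where
  lem : ∀ s u d → s * u * d ≡ u * (s * d)
  lem = solve-∀

punchIn-fromℕ : (k : Fin m) → punchIn (fromℕ m) k ≡ inject₁ k
punchIn-fromℕ zero    = refl
punchIn-fromℕ (suc k) = cong suc (punchIn-fromℕ k)

punchIn-inject₁ : (i : Fin (suc m)) (j : Fin m) →
                  punchIn (inject₁ i) (inject₁ j) ≡ inject₁ (punchIn i j)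
punchIn-inject₁ zero    j       = refl
punchIn-inject₁ (suc i) zero    = refl
punchIn-inject₁ (suc i) (suc j) = cong suc (punchIn-inject₁ i j)

punchIn-inject₁-fromℕ : ∀ m → punchIn (inject₁ (fromℕ m)) (fromℕ m) ≡ fromℕ (suc m)
punchIn-inject₁-fromℕ zero    = refl
punchIn-inject₁-fromℕ (suc m) = cong suc (punchIn-inject₁-fromℕ m)

inject₁≢fromℕ : {i : Fin m} → inject₁ i ≢ fromℕ m
inject₁≢fromℕ = Fin.fromℕ≢inject₁ ∘ sym

tilde-row : (C : Matrix (suc m)) (i : Fin m) → tilde C (inject₁ i) ≡ C (inject₁ i)
tilde-row {m} C i = updateAt-minimal (inject₁ i) (fromℕ m) C inject₁≢fromℕ

tilde-lastRow : (C : Matrix (suc m)) →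
                tilde C (fromℕ m) ≡ updateAt (C (fromℕ m)) (fromℕ m) (const (+ 3))
tilde-lastRow {m} C = updateAt-updates (fromℕ m) C

tilde-corner : (C : Matrix (suc m)) → tilde C (fromℕ m) (fromℕ m) ≡ + 3
tilde-corner {m} C rewrite tilde-lastRow C = updateAt-updates (fromℕ m) (C (fromℕ m))

tilde-column : (C : Matrix (suc m)) (i : Fin (suc m)) (j : Fin m) →
               tilde C i (inject₁ j) ≡ C i (inject₁ j)
tilde-column {m} C i j with view i
... | ‵inject₁ i rewrite tilde-row C i = refl
... | ‵fromℕ     rewrite tilde-lastRow C =
  updateAt-minimal (inject₁ j) (fromℕ m) (C (fromℕ m)) inject₁≢fromℕ

-- The last rows of `C` and `tilde C` differ by a multiple of the last unit vector, whose cofactor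
-- is the leading minor. The sign of that cofactor cancels against the global sign of the expansion.
det-tilde : (C : Matrix (suc m)) →
  det C ≡ det (tilde C) + (C (fromℕ m) (fromℕ m) - + 3) * det (leading C)
det-tilde {m} C = begin
  det C
    ≡⟨ last-expansion m C ⟩
  σ * alongLast (init C) (last C)
    ≡⟨ cong (σ *_) (alongLast-cong {T = init (tilde C)}
         (λ i j → cong (λ row → row j) (sym (tilde-row C i))) lastRow) ⟩
  σ * alongLast T (λ j → 1ℤ * last (tilde C) j + c * unit (fromℕ m) j)
    ≡⟨ cong (σ *_) (alongLast-linear T 1ℤ c (last (tilde C)) (unit (fromℕ m))) ⟩
  σ * (1ℤ * alongLast T (last (tilde C)) + c * alongLast T (unit (fromℕ m)))
    ≡⟨ cong (λ x → σ * (1ℤ * alongLast T (last (tilde C)) + c * x))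
         (trans (alongLast-unit T (fromℕ m)) (cong₂ _*_ (cong (-1ℤ ^_) (Fin.toℕ-fromℕ m)) minor)) ⟩
  σ * (1ℤ * alongLast T (last (tilde C)) + c * (σ * det (leading C)))
    ≡⟨ lem σ (alongLast T (last (tilde C))) c (det (leading C)) ⟩
  σ * alongLast T (last (tilde C)) + σ * σ * (c * det (leading C))
    ≡⟨ cong₂ (λ x y → x + y * (c * det (leading C))) (last-expansion m (tilde C)) (sym (sgn² m)) ⟨
  det (tilde C) + 1ℤ * (c * det (leading C))
    ≡⟨ cong (λ x → det (tilde C) + x) (*-identityˡ (c * det (leading C))) ⟩
  det (tilde C) + c * det (leading C) ∎
  where
  σ = -1ℤ ^ m
  c = C (fromℕ m) (fromℕ m) - + 3
  T = init (tilde C)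

  lem : ∀ s a c d → s * (1ℤ * a + c * (s * d)) ≡ s * a + s * s * (c * d)
  lem = solve-∀
  lem₁ : ∀ x t → x ≡ 1ℤ * t + (x - t) * 1ℤ
  lem₁ = solve-∀
  lem₂ : ∀ x c → x ≡ 1ℤ * x + c * 0ℤ
  lem₂ = solve-∀

  minor : det (dropColumn T (fromℕ m)) ≡ det (leading C)
  minor = det-cong λ i k → trans
    (cong (λ row → row (punchIn (fromℕ m) k)) (tilde-row C i))
    (cong (C (inject₁ i)) (punchIn-fromℕ k))

  lastRow : ∀ j → last C j ≡ 1ℤ * last (tilde C) j + c * unit (fromℕ m) j
  lastRow j with view j
  ... | ‵fromℕ rewrite tilde-corner C | unit-diagonal (fromℕ m) = lem₁ (C (fromℕ m) (fromℕ m)) (+ 3)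
  ... | ‵inject₁ j
    rewrite tilde-column C (fromℕ m) j
          | unit-off-diagonal (Fin.fromℕ≢inject₁ {i = j}) = lem₂ (C (fromℕ m) (inject₁ j)) c

_∷ʳ_ : ∀ {a} {A : Set a} → Vector A m → A → Vector A (suc m)
_∷ʳ_ {m} v a = insertAt v (fromℕ m) a

∷ʳ-inject₁ : ∀ {a} {A : Set a} (v : Vector A m) (a : A) i → (v ∷ʳ a) (inject₁ i) ≡ v i
∷ʳ-inject₁ {m} v a i =
  trans (cong (v ∷ʳ a) (sym (punchIn-fromℕ i))) (insertAt-punchIn v (fromℕ m) a i)

∷ʳ-fromℕ : ∀ {a} {A : Set a} (v : Vector A m) (a : A) → (v ∷ʳ a) (fromℕ m) ≡ a
∷ʳ-fromℕ {m} v a = insertAt-lookup v (fromℕ m) a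

-- The last row and column of C̃ repeated once, with the diagonal restored to n.
double : ℤ → Matrix (suc m) → Matrix (suc (suc m))
double n C = (λ i → C i ∷ʳ last (tilde C i)) ∷ʳ (last (tilde C) ∷ʳ n)

module _ (n : ℤ) (C : Matrix (suc m)) where
  private
    rows : Vector (Vector ℤ (suc (suc m))) (suc m)
    rows i = C i ∷ʳ last (tilde C i)

    lastR : Vector ℤ (suc (suc m))
    lastR = last (tilde C) ∷ʳ n

  double-leading : ∀ i j → double n C (inject₁ i) (inject₁ j) ≡ C i j
  double-leading i j = trans
    (cong (λ row → row (inject₁ j)) (∷ʳ-inject₁ rows lastR i))
    (∷ʳ-inject₁ (C i) (last (tilde C i)) j)

  double-lastColumn : ∀ i → double n C (inject₁ i) (fromℕ (suc m)) ≡ last (tilde C i)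
  double-lastColumn i = trans
    (cong (λ row → row (fromℕ (suc m))) (∷ʳ-inject₁ rows lastR i))
    (∷ʳ-fromℕ (C i) (last (tilde C i)))

  double-lastRow : ∀ j → double n C (fromℕ (suc m)) (inject₁ j) ≡ last (tilde C) j
  double-lastRow j = trans
    (cong (λ row → row (inject₁ j)) (∷ʳ-fromℕ rows lastR))
    (∷ʳ-inject₁ (last (tilde C)) n j)

  double-corner : double n C (fromℕ (suc m)) (fromℕ (suc m)) ≡ n
  double-corner = trans
    (cong (λ row → row (fromℕ (suc m))) (∷ʳ-fromℕ rows lastR))
    (∷ʳ-fromℕ (last (tilde C)) n)

  -- The last row is the one before it plus (n − 3) times the difference of the
  -- last two unit vectors; the first summand contributes nothing.
  det-double : last (last C) ≡ n → det (double n C) ≡ (n - + 3) * (det C + det (tilde C))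
  det-double cₗₗ≡n = begin
    det F
      ≡⟨ last-expansion (suc m) F ⟩
    σ * alongLast T (last F)
      ≡⟨ cong (σ *_) (alongLast-cong {S = T} (λ _ _ → refl) lastRow) ⟩
    σ * alongLast T (λ j → 1ℤ * last T j + c * (1ℤ * unit ℓ j + -1ℤ * unit p j))
      ≡⟨ cong (σ *_) (trans
           (alongLast-linear T 1ℤ c (last T) (λ j → 1ℤ * unit ℓ j + -1ℤ * unit p j))
           (cong₂ (λ x y → 1ℤ * x + c * y) (alongLast-last T)
             (alongLast-linear T 1ℤ -1ℤ (unit ℓ) (unit p)))) ⟩
    σ * (1ℤ * 0ℤ + c * (1ℤ * alongLast T (unit ℓ) + -1ℤ * alongLast T (unit p)))
      ≡⟨ cong₂ (λ x y → σ * (1ℤ * 0ℤ + c * (1ℤ * x + -1ℤ * y)))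
           (trans (alongLast-unit T ℓ) (cong₂ _*_ (cong (-1ℤ ^_) (Fin.toℕ-fromℕ (suc m))) minorℓ))
           (trans (alongLast-unit T p) (cong₂ _*_
             (cong (-1ℤ ^_) (trans (Fin.toℕ-inject₁ (fromℕ m)) (Fin.toℕ-fromℕ m))) minorₚ)) ⟩
    σ * (1ℤ * 0ℤ + c * (1ℤ * (σ * det C) + -1ℤ * (τ * det (tilde C))))
      ≡⟨ lem τ c (det C) (det (tilde C)) ⟩
    τ * τ * (c * (det C + det (tilde C)))
      ≡⟨ cong (_* (c * (det C + det (tilde C)))) (sgn² m) ⟩
    1ℤ * (c * (det C + det (tilde C)))
      ≡⟨ *-identityˡ (c * (det C + det (tilde C))) ⟩
    c * (det C + det (tilde C)) ∎
    where
    σ = -1ℤ ^ suc m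
    τ = -1ℤ ^ m
    c = n - + 3
    F = double n C
    T = init F
    ℓ = fromℕ (suc m)
    p = inject₁ (fromℕ m)

    lem : ∀ t c d e → (-1ℤ * t) * (1ℤ * 0ℤ + c * (1ℤ * ((-1ℤ * t) * d) + -1ℤ * (t * e)))
          ≡ t * t * (c * (d + e))
    lem = solve-∀
    lem₁ : ∀ x y → x ≡ 1ℤ * y + (x - y) * (1ℤ * 1ℤ + -1ℤ * 0ℤ)
    lem₁ = solve-∀
    lem₂ : ∀ x y → y ≡ 1ℤ * x + (x - y) * (1ℤ * 0ℤ + -1ℤ * 1ℤ)
    lem₂ = solve-∀
    lem₃ : ∀ x c → x ≡ 1ℤ * x + c * (1ℤ * 0ℤ + -1ℤ * 0ℤ)
    lem₃ = solve-∀

    lastRow : ∀ j → last F j ≡ 1ℤ * last T j + c * (1ℤ * unit ℓ j + -1ℤ * unit p j)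
    lastRow j with view j
    ... | ‵fromℕ
      rewrite double-corner | double-lastColumn (fromℕ m) | tilde-corner C
            | unit-diagonal ℓ | unit-off-diagonal (inject₁≢fromℕ {i = fromℕ m}) = lem₁ n (+ 3)
    ... | ‵inject₁ i with view i
    ...   | ‵fromℕ
      rewrite double-lastRow (fromℕ m) | double-leading (fromℕ m) (fromℕ m) | tilde-corner C
            | cₗₗ≡n | unit-diagonal p | unit-off-diagonal (Fin.fromℕ≢inject₁ {i = fromℕ m}) = lem₂ n (+ 3)
    ...   | ‵inject₁ k
      rewrite double-lastRow (inject₁ k) | double-leading (fromℕ m) (inject₁ k)
            | tilde-column C (fromℕ m) k
            | unit-off-diagonal (Fin.fromℕ≢inject₁ {i = inject₁ k})
            | unit-off-diagonal {i = p} {j = inject₁ (inject₁ k)}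
                (Fin.fromℕ≢inject₁ ∘ Fin.inject₁-injective) =
      lem₃ (C (fromℕ m) (inject₁ k)) c

    minorℓ : det (dropColumn T ℓ) ≡ det C
    minorℓ = det-cong λ i k → trans (cong (T i) (punchIn-fromℕ k)) (double-leading i k)

    -- Deleting the last column of `C` inside `T` promotes its copy, which has 3 in the corner. The
    -- two cofactors have opposite signs and so do their coefficients, whence the sum of
    -- determinants.
    minorₚ : det (dropColumn T p) ≡ det (tilde C)
    minorₚ = det-cong entry
      where
      entry : ∀ i k → T i (punchIn p k) ≡ tilde C i k
      entry i k with view k
      ... | ‵fromℕ rewrite punchIn-inject₁-fromℕ m = double-lastColumn i
      ... | ‵inject₁ k rewrite punchIn-inject₁ (fromℕ m) k | punchIn-fromℕ k =
        trans (double-leading i (inject₁ k)) (sym (tilde-column C i k))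

tilde-symmetric : {C : Matrix (suc m)} → Symmetric C → ∀ i → last (tilde C i) ≡ last (tilde C) i
tilde-symmetric {m} {C} symC i with view i
... | ‵fromℕ     = refl
... | ‵inject₁ i = trans (cong last (tilde-row C i))
  (trans (symC (inject₁ i) (fromℕ m)) (sym (tilde-column C (fromℕ m) i)))

tilde-entries : (P : ℤ → Set) {C : Matrix (suc m)} → (∀ i j → P (C i j)) → P (+ 3) →
                ∀ i → P (last (tilde C) i)
tilde-entries {m} P {C} PC P3 i with view i
... | ‵fromℕ     = subst P (sym (tilde-corner C)) P3
... | ‵inject₁ i = subst P (sym (tilde-column C (fromℕ m) i)) (PC (fromℕ m) (inject₁ i))

-- Closure of `ℭ` under leading submatrices and doubling

pivots-cong : {C D : Matrix m} → (∀ i j → C i j ≡ D i j) → Pivots C → Pivots D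
pivots-cong {zero}  C≗D _       = tt
pivots-cong {suc m} {C} {D} C≗D (a , p) = subst (0ℤ <_) (C≗D zero zero) a ,
  pivots-cong {C = schur C} {schur D} (λ i j → cong₂ _+_
    (cong₂ _*_ (C≗D zero zero) (C≗D (suc i) (suc j)))
    (cong₂ (λ x y → - x * y) (C≗D (suc i) zero) (C≗D zero (suc j)))) p

mod-refl : ∀ {k} i → i ≡ i [mod k ]
mod-refl i = divides 0ℤ (+-inverseʳ i)

mod-sym : ∀ {k i j} → i ≡ j [mod k ] → j ≡ i [mod k ]
mod-sym {k} {i} {j} (divides q eq) = divides (- q) (begin
  j - i       ≡⟨ lem i j ⟩
  - (i - j)   ≡⟨ cong -_ eq ⟩
  - (q * k)   ≡⟨ neg-distribˡ-* q k ⟩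
  - q * k     ∎)
  where
  lem : ∀ i j → j - i ≡ - (i - j)
  lem = solve-∀

open ℭ

module _ {n : ℤ} where

  pivots : {C : Matrix m} → C ∈ ℭ n m → Pivots C
  pivots {C = C} C∈ℭ = positiveDefinite⇒pivots C (symmetric C∈ℭ) (positiveDefinite C∈ℭ)

  ℭ-leading : {C : Matrix (suc m)} → C ∈ ℭ n (suc m) → leading C ∈ ℭ n m
  ℭ-leading {C = C} C∈ℭ = record
    { symmetric        = symC
    ; positiveDefinite = pivots⇒positiveDefinite (leading C) symC (pivots-leading C (pivots C∈ℭ))
    ; diagonal         = diagonal C∈ℭ ∘ inject₁
    ; congruent        = λ i j → congruent C∈ℭ (inject₁ i) (inject₁ j)
    }
    where
    symC : Symmetric (leading C)
    symC i j = symmetric C∈ℭ (inject₁ i) (inject₁ j)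

  double-ℭ : {C : Matrix (suc m)} → n ≡ + 3 [mod + 4 ] → + 3 < n →
             C ∈ ℭ n (suc m) → 0ℤ < det (tilde C) → double n C ∈ ℭ n (suc (suc m))
  double-ℭ {m} {C} n≡3 3<n C∈ℭ 0<detC̃ = record
    { symmetric        = symF
    ; positiveDefinite = pivots⇒positiveDefinite F symF (pivots-extend F leadingF 0<detF)
    ; diagonal         = diagF
    ; congruent        = congF
    }
    where
    F = double n C
    ℓ = fromℕ (suc m)

    symF : Symmetric F
    symF i j with view i | view j
    ... | ‵fromℕ     | ‵fromℕ     = refl
    ... | ‵fromℕ     | ‵inject₁ j = trans (double-lastRow n C j)
      (trans (sym (tilde-symmetric (symmetric C∈ℭ) j)) (sym (double-lastColumn n C j)))
    ... | ‵inject₁ i | ‵fromℕ     = trans (double-lastColumn n C i)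
      (trans (tilde-symmetric (symmetric C∈ℭ) i) (sym (double-lastRow n C i)))
    ... | ‵inject₁ i | ‵inject₁ j = trans (double-leading n C i j)
      (trans (symmetric C∈ℭ i j) (sym (double-leading n C j i)))

    leadingF : Pivots (leading F)
    leadingF = pivots-cong (λ i j → sym (double-leading n C i j)) (pivots C∈ℭ)

    0<detF : 0ℤ < det F
    0<detF = subst (0ℤ <_) (sym (det-double n C (diagonal C∈ℭ (fromℕ m))))
      (0<i*j (i<j⇒0<j-i 3<n) (+-mono-< (pivots⇒0<det C (pivots C∈ℭ)) 0<detC̃))

    diagF : ∀ i → F i i ≡ n
    diagF i with view i
    ... | ‵fromℕ     = double-corner n C
    ... | ‵inject₁ i = trans (double-leading n C i i) (diagonal C∈ℭ i)

    -- The entry 3 now stands off the diagonal; `n≡3` is what makes it admissible.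
    congC̃ : ∀ i → last (tilde C) i ≡ n [mod + 4 ]
    congC̃ = tilde-entries (λ x → x ≡ n [mod + 4 ]) (congruent C∈ℭ) (mod-sym {i = n} {j = + 3} n≡3)

    congF : ∀ i j → F i j ≡ n [mod + 4 ]
    congF i j with view i | view j
    ... | ‵fromℕ     | ‵fromℕ     rewrite double-corner n C = mod-refl n
    ... | ‵fromℕ     | ‵inject₁ j rewrite double-lastRow n C j = congC̃ j
    ... | ‵inject₁ i | ‵fromℕ
      rewrite double-lastColumn n C i | tilde-symmetric (symmetric C∈ℭ) i = congC̃ i
    ... | ‵inject₁ i | ‵inject₁ j rewrite double-leading n C i j = congruent C∈ℭ i j

-- Finiteness of ℭ and existence of maxima

sum-two-units : ∀ s i t j (f : Vector ℤ m) →
  ∑[ k < m ] ((s * unit i k + t * unit j k) * f k) ≡ s * f i + t * f j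
sum-two-units {m} s i t j f = begin
  ∑[ k < m ] ((s * unit i k + t * unit j k) * f k)
    ≡⟨ sum-cong-≗ (λ k → lem s (unit i k) t (unit j k) (f k)) ⟩
  ∑[ k < m ] (s * (unit i k * f k) + t * (unit j k * f k))
    ≡⟨ sum-linear s t (λ k → unit i k * f k) (λ k → unit j k * f k) ⟩
  s * ∑[ k < m ] (unit i k * f k) + t * ∑[ k < m ] (unit j k * f k)
    ≡⟨ cong₂ (λ x y → s * x + t * y) (sum-unit i f) (sum-unit j f) ⟩
  s * f i + t * f j ∎
  where
  lem : ∀ s u t v f → (s * u + t * v) * f ≡ s * (u * f) + t * (v * f)
  lem = solve-∀

quad-two-units : (C : Matrix m) → ∀ s i t j →
  quad C (λ k → s * unit i k + t * unit j k) ≡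
  s * (s * C i i + t * C i j) + t * (s * C j i + t * C j j)
quad-two-units {m} C s i t j = begin
  quad C x
    ≡⟨ sum-cong-≗ (λ k → trans
         (sum-cong-≗ λ l → lem (x k) (C k l) (x l))
         (sym (*-distribˡ-sum (x k) (λ l → x l * C k l)))) ⟩
  ∑[ k < m ] (x k * ∑[ l < m ] (x l * C k l))
    ≡⟨ sum-cong-≗ (λ k → cong (x k *_) (sum-two-units s i t j (C k))) ⟩
  ∑[ k < m ] (x k * (s * C k i + t * C k j))
    ≡⟨ sum-two-units s i t j (λ k → s * C k i + t * C k j) ⟩
  s * (s * C i i + t * C i j) + t * (s * C j i + t * C j j) ∎
  where
  x = λ k → s * unit i k + t * unit j k
  lem : ∀ p c q → p * c * q ≡ p * (q * c)
  lem = solve-∀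

0<i+i⇒0≤i : ∀ {i} → 0ℤ < i + i → 0ℤ ≤ i
0<i+i⇒0≤i {+ _} _ = +≤+ ℕ.z≤n

∣i∣≤n : ∀ {n i} → 0ℤ ≤ + n + i → 0ℤ ≤ + n - i → ∣ i ∣ ℕ.≤ n
∣i∣≤n {n} {+ i}      _     0≤n-i = drop‿+≤+ (0≤i-j⇒j≤i 0≤n-i)
∣i∣≤n {n} { -[1+ i ] } 0≤n+i _   = drop‿+≤+ (0≤i-j⇒j≤i {j = +[1+ i ]} 0≤n+i)

-- Off the diagonal, the form at the sum and at the difference of two unit vectors equals twice
-- `n + c` and twice `n - c`, with `c` the entry.
ℭ-bounded : ∀ {n} {C : Matrix m} → C ∈ ℭ (+ n) m → ∀ i j → ∣ C i j ∣ ℕ.≤ n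
ℭ-bounded {m} {n} {C} C∈ℭ i j with i Fin.≟ j
... | yes refl = ℕ.≤-reflexive (cong ∣_∣ (diagonal C∈ℭ i))
... | no  i≢j  = ∣i∣≤n {n} {C i j}
  (0<i+i⇒0≤i (subst (0ℤ <_) (trans (quad-n 1ℤ) (lem₁ (+ n) (C i j))) (0<quad 1ℤ)))
  (0<i+i⇒0≤i (subst (0ℤ <_) (trans (quad-n -1ℤ) (lem₂ (+ n) (C i j))) (0<quad -1ℤ)))
  where
  lem₁ : ∀ n c → 1ℤ * (1ℤ * n + 1ℤ * c) + 1ℤ * (1ℤ * c + 1ℤ * n) ≡ (n + c) + (n + c)
  lem₁ = solve-∀
  lem₂ : ∀ n c → 1ℤ * (1ℤ * n + -1ℤ * c) + -1ℤ * (1ℤ * c + -1ℤ * n) ≡ (n - c) + (n - c)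
  lem₂ = solve-∀
  lem₃ : ∀ t → 1ℤ * 1ℤ + t * 0ℤ ≡ 1ℤ
  lem₃ = solve-∀

  x : ℤ → Vector ℤ m
  x t k = 1ℤ * unit i k + t * unit j k

  xᵢ≡1 : ∀ t → x t i ≡ 1ℤ
  xᵢ≡1 t = trans
    (cong₂ (λ a b → 1ℤ * a + t * b) (unit-diagonal i) (unit-off-diagonal (i≢j ∘ sym))) (lem₃ t)

  0<quad : ∀ t → 0ℤ < quad C (x t)
  0<quad t = positiveDefinite C∈ℭ (x t) (i , λ xᵢ≡0 → contradiction (trans (sym (xᵢ≡1 t)) xᵢ≡0) λ ())

  quad-n : ∀ t → quad C (x t) ≡ 1ℤ * (1ℤ * + n + t * C i j) + t * (1ℤ * C i j + t * + n)
  quad-n t = trans (quad-two-units C 1ℤ i t j)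
    (cong₂ _+_ (cong (λ a → 1ℤ * (1ℤ * a + t * C i j)) (diagonal C∈ℭ i))
      (cong₂ (λ a b → t * (1ℤ * a + t * b)) (symmetric C∈ℭ j i) (diagonal C∈ℭ j)))

vectors : ∀ {a} {A : Set a} → List A → ∀ m → List (Vector A m)
vectors xs zero    = List.[ (λ ()) ]
vectors xs (suc m) = cartesianProductWith _∷_ xs (vectors xs m)

-- A given function is found in the list only up to entrywise agreement, so `P i` states what entry
-- `i` must satisfy. Used twice, for rows and inside each row, it locates a matrix.
Any-vectors : ∀ {a p} {A : Set a} {xs : List A} (P : Fin m → A → Set p) →
              (∀ i → Any (P i) xs) → Any (λ v → ∀ i → P i (v i)) (vectors xs m)
Any-vectors {zero}  P Pxs = here λ ()
Any-vectors {suc m} P Pxs = cartesianProductWith⁺ _∷_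
  (λ { p ps zero → p ; p ps (suc i) → ps i }) (Pxs zero) (Any-vectors (P ∘ suc) (Pxs ∘ suc))

integersUpTo : ℕ → List ℤ
integersUpTo n = List.map (λ k → + k) (upTo (suc n)) ++ List.map (λ k → - (+ k)) (upTo (suc n))

∈-integersUpTo : ∀ {n i} → ∣ i ∣ ℕ.≤ n → i ∈ₗ integersUpTo n
∈-integersUpTo {n} {+ i}        ∣i∣≤n = ∈-++⁺ˡ (∈-map⁺ (λ k → + k) (∈-upTo⁺ (ℕ.s≤s ∣i∣≤n)))
∈-integersUpTo {n} { -[1+ i ] } ∣i∣≤n =
  ∈-++⁺ʳ (List.map (λ k → + k) (upTo (suc n))) (∈-map⁺ (λ k → - (+ k)) (∈-upTo⁺ (ℕ.s≤s ∣i∣≤n)))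

pivots? : (C : Matrix m) → Dec (Pivots C)
pivots? {zero}  C = yes tt
pivots? {suc m} C = (0ℤ <? C zero zero) ×-dec pivots? (schur C)

ℭ? : ∀ n (C : Matrix m) → Dec (C ∈ ℭ n m)
ℭ? n C = map′
  (λ (symC , p , d , c) → record
    { symmetric        = symC
    ; positiveDefinite = pivots⇒positiveDefinite C symC p
    ; diagonal         = d
    ; congruent        = c
    })
  (λ C∈ℭ → symmetric C∈ℭ , pivots C∈ℭ , diagonal C∈ℭ , congruent C∈ℭ)
  (all? (λ i → all? λ j → C i j ≟ C j i) ×-dec pivots? C ×-dec
   all? (λ i → C i i ≟ n) ×-dec all? (λ i → all? λ j → + 4 ∣? (C i j - n)))

ℭ-cong : ∀ {n} {C D : Matrix m} → (∀ i j → C i j ≡ D i j) → C ∈ ℭ n m → D ∈ ℭ n m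
ℭ-cong {n = n} {C} {D} C≗D C∈ℭ = record
  { symmetric        = symD
  ; positiveDefinite = pivots⇒positiveDefinite D symD (pivots-cong C≗D (pivots C∈ℭ))
  ; diagonal         = λ i → trans (sym (C≗D i i)) (diagonal C∈ℭ i)
  ; congruent        = λ i j → subst (λ x → x ≡ n [mod + 4 ]) (C≗D i j) (congruent C∈ℭ i j)
  }
  where
  symD : Symmetric D
  symD i j = trans (sym (C≗D i j)) (trans (symmetric C∈ℭ i j) (C≗D j i))

inject≤-suc : ∀ {r} (i : Fin r) (r≤m : r ℕ.≤ m) (r≤1+m : r ℕ.≤ suc m) →
              inject≤ i r≤1+m ≡ inject₁ (inject≤ i r≤m)
inject≤-suc {suc m} zero    _   _     = refl
inject≤-suc {suc m} (suc i) r≤m r≤1+m = cong suc (inject≤-suc i (ℕ.s≤s⁻¹ r≤m) (ℕ.s≤s⁻¹ r≤1+m))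

module _ {n : ℕ} {r} (M : Matrix r) where

  -- The bound stored in a membership proof may differ from `r≤m`, but `inject≤` ignores which proof
  -- it receives, so the entry conditions coincide by computation.
  𝔈? : r ℕ.≤ m → (E : Matrix m) → Dec (E ∈ 𝔈 (+ n) M m)
  𝔈? r≤m E = map′ (λ (E∈ℭ , lead) → E∈ℭ , r≤m , lead) (λ (E∈ℭ , _ , lead) → E∈ℭ , lead)
    (ℭ? (+ n) E ×-dec all? λ i → all? λ j → E (inject≤ i r≤m) (inject≤ j r≤m) ≟ M i j)

  𝔈-cong : {C D : Matrix m} → (∀ i j → C i j ≡ D i j) → C ∈ 𝔈 (+ n) M m → D ∈ 𝔈 (+ n) M m
  𝔈-cong C≗D (C∈ℭ , r≤m , lead) =
    ℭ-cong C≗D C∈ℭ , r≤m , λ i j → trans (sym (C≗D (inject≤ i r≤m) (inject≤ j r≤m))) (lead i j)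

  𝔈-leading : {E : Matrix (suc m)} → r ℕ.≤ m → E ∈ 𝔈 (+ n) M (suc m) → leading E ∈ 𝔈 (+ n) M m
  𝔈-leading {E = E} r≤m (E∈ℭ , r≤1+m , lead) = ℭ-leading E∈ℭ , r≤m , λ i j →
    trans (cong₂ E (sym (inject≤-suc i r≤m r≤1+m)) (sym (inject≤-suc j r≤m r≤1+m))) (lead i j)

  MaxDet : Matrix m → Set
  MaxDet {m} E = E ∈ 𝔈 (+ n) M m × (∀ D → D ∈ 𝔈 (+ n) M m → det D ≤ det E)

  max-exists : {E : Matrix m} → E ∈ 𝔈 (+ n) M m → ∃[ G ] MaxDet {m} G
  max-exists {m} {E} E∈𝔈@(_ , r≤m , _) =
    G , argmax-all det {P = 𝔈 (+ n) M m} E∈𝔈 (all-filter (𝔈? r≤m) matrices) , maximal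
    where
    matrices : List (Matrix m)
    matrices = vectors (vectors (integersUpTo n) m) m

    -- The given member `E` is the default of `argmax`, so that the result lies in `𝔈` even if the
    -- filtered list is empty.
    G = argmax det E (filter (𝔈? r≤m) matrices)

    maximal : ∀ D → D ∈ 𝔈 (+ n) M m → det D ≤ det G
    maximal D D∈𝔈 =
      -- `D` itself need not be listed; an entrywise equal `D′` is, and it has the same determinant.
      let D′ , D′∈matrices , D≗D′ = find (Any-vectors (λ i v → ∀ j → D i j ≡ v j) λ i →
            Any-vectors (λ j x → D i j ≡ x) λ j → ∈-integersUpTo (ℭ-bounded (proj₁ D∈𝔈) i j))
      in ≤-trans (≤-reflexive (det-cong D≗D′))
           (All.lookup (f[xs]≤f[argmax] {f = det} E (filter (𝔈? r≤m) matrices))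
           (∈-filter⁺ (𝔈? r≤m) D′∈matrices (𝔈-cong D≗D′ D∈𝔈)))

  MaxDet⇒IsMaxOf : {E : Matrix m} → MaxDet E → det E IsMaxOf dets (𝔈 (+ n) M m)
  MaxDet⇒IsMaxOf {E = E} (E∈𝔈 , max) = (E , E∈𝔈 , refl) , λ { e (D , D∈𝔈 , refl) → max D D∈𝔈 }

  grow : {E : Matrix (suc m)} → + n ≡ + 3 [mod + 4 ] → + 3 < + n →
         MaxDet E → 0ℤ < det (tilde E) →
         ∃[ G ] MaxDet {suc (suc m)} G × (+ n - + 3) * det E < det G
  grow {m} {E} n≡3 3<n ((E∈ℭ , r≤m , lead) , _) 0<detẼ =
    let G , G-max = max-exists F∈𝔈
    in G , G-max , <-≤-trans detE<detF (proj₂ G-max F F∈𝔈)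
    where
    c = + n - + 3
    F = double (+ n) E

    r≤1+m = ℕ.m≤n⇒m≤1+n r≤m

    F∈𝔈 : F ∈ 𝔈 (+ n) M (suc (suc m))
    F∈𝔈 = double-ℭ n≡3 3<n E∈ℭ 0<detẼ , r≤1+m , λ i j → trans
      (cong₂ F (inject≤-suc i r≤m r≤1+m) (inject≤-suc j r≤m r≤1+m))
      (trans (double-leading (+ n) E (inject≤ i r≤m) (inject≤ j r≤m)) (lead i j))

    detE<detF : c * det E < det F
    detE<detF = subst₂ _<_ (+-identityʳ (c * det E))
      (trans (sym (*-distribˡ-+ c (det E) (det (tilde E))))
        (sym (det-double (+ n) E (diagonal E∈ℭ (fromℕ m)))))
      (+-monoʳ-< (c * det E) (0<i*j (i<j⇒0<j-i 3<n) 0<detẼ))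

  grow-tilde : {E : Matrix (suc m)} {G : Matrix (suc (suc m))} → + 3 < + n → r ℕ.≤ suc m →
               MaxDet E → MaxDet G → (+ n - + 3) * det E < det G → 0ℤ < det (tilde G)
  grow-tilde {m} {E} {G} 3<n r≤m E-max (G∈𝔈 , _) detE<detG =
    subst (0ℤ <_) (lem (det (tilde G)) (c * det (leading G)))
      (i<j⇒0<j-i (subst (c * det (leading G) <_) detG (≤-<-trans leading≤E detE<detG)))
    where
    c = + n - + 3

    detG : det G ≡ det (tilde G) + c * det (leading G)
    detG = trans (det-tilde G)
      (cong (λ x → det (tilde G) + (x - + 3) * det (leading G)) (diagonal (proj₁ G∈𝔈) (fromℕ (suc m))))

    leading≤E : c * det (leading G) ≤ c * det E
    leading≤E = *-monoˡ-≤-nonNeg c {{nonNegative (<⇒≤ (i<j⇒0<j-i 3<n))}}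
      (proj₂ E-max (leading G) (𝔈-leading r≤m G∈𝔈))

    lem : ∀ x y → (x + y) - y ≡ x
    lem = solve-∀

-- Induction on the order

module _ {n r : ℕ} (n≡3 : + n ≡ + 3 [mod + 4 ]) (3<n : + 3 < + n)
         (M : Matrix (suc r)) (M∈ℭ : M ∈ ℭ (+ n) (suc r)) (0<detM̃ : 0ℤ < det (tilde M)) where

  -- Indices are one below the orders, so every matrix has a last entry, and `≤′` lets the induction
  -- climb from the order of `M`. Maximality and the sign of `det (tilde E)` are carried together
  -- because the next sign depends on both. In the base case a member of `𝔈` agrees with `M` in
  -- every entry.
  max-tilde>0 : ∀ {m} → r ℕ.≤′ m → ∃[ E ] MaxDet {n} M {suc m} E × 0ℤ < det (tilde E)
  max-tilde>0 ℕ.≤′-refl = M , (M∈𝔈 , maximal) , 0<detM̃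
    where
    M∈𝔈 : M ∈ 𝔈 (+ n) M (suc r)
    M∈𝔈 = M∈ℭ , ℕ.≤-refl , λ i j → cong₂ M (Fin.inject≤-refl i ℕ.≤-refl) (Fin.inject≤-refl j ℕ.≤-refl)

    maximal : ∀ D → D ∈ 𝔈 (+ n) M (suc r) → det D ≤ det M
    maximal D (_ , r≤r , lead) = ≤-reflexive (det-cong λ i j →
      trans (cong₂ D (sym (Fin.inject≤-refl i r≤r)) (sym (Fin.inject≤-refl j r≤r))) (lead i j))
  max-tilde>0 (ℕ.≤′-step r≤′m) =
    let E , E-max , 0<detẼ    = max-tilde>0 r≤′m
        G , G-max , detE<detG = grow M n≡3 3<n E-max 0<detẼ
    in G , G-max , grow-tilde M 3<n (ℕ.s≤s (ℕ.≤′⇒≤ r≤′m)) E-max G-max detE<detG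

theorem7 : (n : ℤ) → n ≡ + 3 [mod + 4 ] → n > + 3 →
    (r m : ℕ) → 1 ℕ.≤ r → r ℕ.< m →
    (M : Matrix r) → M ∈ ℭ n r → det (tilde M) > 0ℤ →
    ∃[ a ] ∃[ b ]
    a IsMaxOf dets (𝔈 n M m) ×
    b IsMaxOf dets (𝔈 n M (m ∸ 1)) ×
    a > (n - + 3) * b
-- A negative `n` contradicts `n > + 3`, and `1 ≤ r < m` makes the order at least two; `E` below has
-- order one less than `G`.
theorem7 (+ n) n≡3 n>3 (suc r) (suc (suc m)) _ (ℕ.s≤s (ℕ.s≤s r≤m)) M M∈ℭ 0<detM̃ =
  let E , E-max , 0<detẼ    = max-tilde>0 n≡3 n>3 M M∈ℭ 0<detM̃ (ℕ.≤⇒≤′ r≤m)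
      G , G-max , detE<detG = grow M n≡3 n>3 E-max 0<detẼ
  in det G , det E , MaxDet⇒IsMaxOf M G-max , MaxDet⇒IsMaxOf M E-max , detE<detG
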